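{- Let $n\geq 5$, let $K\leq\mathrm{Aut}(Q_n)$ be even with $d_K\geq 7$, and let $\Gamma$ be a halved graph of $(Q_n)_K$. Then $\mathrm{Aut}(\Gamma)=N_{E_n: S_n}(K)/K$, where $N_{E_n:S_n}(K)$ acts on vertices by $(x^K)^g:=(x^g)^K$.
   Context: The $n$-cube $Q_n$ has vertex set $\mathbb{F}_2^n$, two vectors adjacent iff their Hamming distance is $1$; $\mathrm{Aut}(Q_n)=\mathbb{F}_2^n: S_n$, where $\mathbb{F}_2^n$ acts by translation and $S_n$ by permuting coordinates; elements are written $(x,\sigma)$. $E_n$ is the subspace of even-weight vectors, so $E_n: S_n$ is an index-$2$ subgroup of $\mathrm{Aut}(Q_n)$; $K\leq\mathrm{Aut}(Q_n)$ is even if $K\leq E_n: S_n$. For $K\leq\mathrm{Aut}(Q_n)$, $d_K:=\min\{d_{Q_n}(x,x^k): x\in\mathbb{F}_2^n,\ 1\neq k\in K\}$ if $K\neq 1$ and $d_K:=\infty$ if $K=1$. The normal quotient $(Q_n)_K$ is the simple graph whose vertices are the $K$-orbits $x^K$, distinct orbits adjacent iff some vertex of one is adjacent in $Q_n$ to some vertex of the other. For a connected bipartite graph $\Pi$, the halved graphs are the two connected components of the distance $2$ graph of $\Pi$ (same vertex set, adjacency = distance exactly $2$ in $\Pi$). -}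

module Defs where

open import Data.Nat using (ℕ; zero; suc; _+_; _≤_)
open import Data.Bool using (Bool; true; false; _xor_)
open import Data.Vec using (Vec; []; _∷_; zipWith; tabulate; lookup)
open import Data.Fin using (Fin)
open import Data.Fin.Permutation using (Permutation′; _⟨$⟩ʳ_; _⟨$⟩ˡ_)
open import Data.Product using (Σ; ∃; ∃-syntax; _×_; _,_)
open import Data.Empty using (⊥)
open import Relation.Nullary using (¬_)
open import Relation.Binary.PropositionalEquality using (_≡_)
open import Relation.Binary.Construct.Closure.ReflexiveTransitive using (Star)
open import Function.Bundles using (_⇔_)

Vtx : ℕ → Set
Vtx n = Vec Bool n

weight : ∀ {n} → Vtx n → ℕ
weight []          = 0
weight (true ∷ x)  = suc (weight x)
weight (false ∷ x) = weight x

_⊕_ : ∀ {n} → Vtx n → Vtx n → Vtx n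
x ⊕ y = zipWith _xor_ x y

dist : ∀ {n} → Vtx n → Vtx n → ℕ
dist x y = weight (x ⊕ y)

QAdj : ∀ {n} → Vtx n → Vtx n → Set
QAdj x y = dist x y ≡ 1

data Even : ℕ → Set where
  ev0  : Even 0
  ev+2 : ∀ {m} → Even m → Even (suc (suc m))

InE : ∀ {n} → Vtx n → Set
InE x = Even (weight x)

-- Aut(Q_n) = F_2^n : S_n, elements (a , σ).
-- Right action:  y^(a,σ) = (y + a)^σ,  where (z^σ)_{iσ} = z_i.

AutQ : ℕ → Set
AutQ n = Vtx n × Permutation′ n

permute : ∀ {n} → Permutation′ n → Vtx n → Vtx n
permute σ z = tabulate (λ j → lookup z (σ ⟨$⟩ˡ j))

act : ∀ {n} → AutQ n → Vtx n → Vtx n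
act (a , σ) y = permute σ (y ⊕ a)

InES : ∀ {n} → AutQ n → Set
InES (a , σ) = InE a

-- equality of group elements (the action on Q_n is faithful)
_≈ᴬ_ : ∀ {n} → AutQ n → AutQ n → Set
g ≈ᴬ h = ∀ x → act g x ≡ act h x

IsIdentity : ∀ {n} → AutQ n → Set
IsIdentity g = ∀ x → act g x ≡ x

record IsSubgroup {n} (K : AutQ n → Set) : Set where
  field
    respects : ∀ g h → g ≈ᴬ h → K g → K h
    hasId    : ∃[ e ] (K e × IsIdentity e)
    closed·  : ∀ g h → K g → K h →
               ∃[ k ] (K k × (∀ x → act k x ≡ act h (act g x)))
    closed⁻¹ : ∀ g → K g → ∃[ k ] (K k × (∀ x → act k (act g x) ≡ x))

IsEvenSub : ∀ {n} → (AutQ n → Set) → Set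
IsEvenSub K = ∀ g → K g → InES g

-- d_K ≥ d   (vacuous when K = 1, matching d_K = ∞)
dK≥ : ∀ {n} → ℕ → (AutQ n → Set) → Set
dK≥ d K = ∀ k → K k → ¬ IsIdentity k → ∀ x → d ≤ dist x (act k x)

-- g ∈ N_{E_n:S_n}(K):  g ∈ E_n:S_n and g⁻¹ K g = K,
-- expressed as: for every k ∈ K there is k' ∈ K with kg = gk', and conversely.
InNormalizer : ∀ {n} → (AutQ n → Set) → AutQ n → Set
InNormalizer K g =
  InES g
  × (∀ k → K k → ∃[ k' ] (K k' × (∀ x → act g (act k x) ≡ act k' (act g x))))
  × (∀ k' → K k' → ∃[ k ] (K k × (∀ x → act g (act k x) ≡ act k' (act g x))))

-- The normal quotient (Q_n)_K: vertices are K-orbits, represented by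
-- vectors up to the orbit relation _∼_.

module Quotient {n : ℕ} (K : AutQ n → Set) where

  _∼_ : Vtx n → Vtx n → Set
  x ∼ y = ∃[ k ] (K k × act k x ≡ y)

  Adj : Vtx n → Vtx n → Set
  Adj x y = ¬ (x ∼ y) × ∃[ x' ] ∃[ y' ] (x ∼ x' × y ∼ y' × QAdj x' y')

  Dist2 : Vtx n → Vtx n → Set
  Dist2 x y = ¬ (x ∼ y) × ¬ Adj x y × ∃[ z ] (Adj x z × Adj z y)

  module Halved (v₀ : Vtx n) where

    VΓ : Vtx n → Set
    VΓ x = ∃[ y ] (Star Dist2 v₀ y × y ∼ x)

    -- f (acting on orbit representatives) induces an automorphism of Γ
    record IsAutΓ (f : Vtx n → Vtx n) : Set where
      field
        wellDef : ∀ x y → VΓ x → x ∼ y → f x ∼ f y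
        maps    : ∀ x → VΓ x → VΓ (f x)
        inj     : ∀ x y → VΓ x → VΓ y → f x ∼ f y → x ∼ y
        surj    : ∀ y → VΓ y → ∃[ x ] (VΓ x × f x ∼ y)
        adj     : ∀ x y → VΓ x → VΓ y → Dist2 x y ⇔ Dist2 (f x) (f y)

{-# OPTIONS --safe #-}
-- Vertices of the quotient at distance 2 are exactly those with representatives at Hamming distance
-- 2, and distinct points of one K-orbit are at distance at least 7, so the half of Q_n containing v₀
-- covers Γ without distorting the neighbourhood of any vertex.  That neighbourhood is the triangular
-- graph T(n), whose automorphisms are coordinate permutations as n ≥ 5.  Hence an automorphism f of Γ
-- agrees around v₀ with an affine map g; the permutations found at neighbouring vertices coincide
-- because they agree on common neighbours, so g lifts f on the whole half.  An element of Aut(Q_n)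
-- preserving every orbit of the half lies in K, and applied to g⁻¹ k g and g k g⁻¹ this shows that
-- g normalises K.
module Submission where

open import Defs
open import Algebra.Bundles using (CommutativeMonoid; CommutativeRing)
import Algebra.Properties.CommutativeMonoid.Sum as Sum
import Algebra.Properties.CommutativeSemigroup as CommutativeSemigroupProperties
open import Data.Bool using (Bool; true; false; _xor_)
import Data.Bool.Properties as 𝔹
open import Data.Empty using (⊥-elim)
open import Data.Fin using (Fin; zero; suc; punchOut)
import Data.Fin.Properties as F
open import Data.Fin.Permutation
  using (Permutation′; _⟨$⟩ʳ_; _⟨$⟩ˡ_; inverseˡ; inverseʳ; permutation; flip; _∘ₚ_)
open import Data.List using (List; []; _∷_; length)
import Data.List as List
import Data.List.Membership.DecPropositional as DecMembership
open import Data.List.Membership.Propositional using (_∈_; _∉_)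
open import Data.List.Relation.Unary.Any using (here; there; index)
import Data.List.Relation.Unary.Any.Properties as Any
open import Data.Nat using (ℕ; zero; suc; _+_; _≤_; _<_; z≤n; s≤s)
import Data.Nat.Properties as ℕ
open import Data.Product using (_×_; _,_; proj₁; proj₂; ∃-syntax)
open import Data.Sum using (_⊎_; inj₁; inj₂)
open import Data.Vec using ([]; _∷_; lookup; replicate)
import Data.Vec.Properties as Vec
open import Function.Base using (_∘_)
open import Function.Bundles using (_⇔_; mk⇔; Equivalence)
open import Level using (0ℓ)
open import Relation.Binary.Bundles using (Setoid)
open import Relation.Binary.Construct.Closure.ReflexiveTransitive using (Star; ε; _◅_; _◅◅_)
open import Relation.Binary.PropositionalEquality
import Relation.Binary.Reasoning.Setoid as SetoidReasoning
open import Relation.Nullary using (¬_; Dec; yes; no)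
open import Relation.Nullary.Decidable using (decidable-stable; ¬?)

private
  variable
    n : ℕ

-- Vector addition over F₂ and the Hamming metric.

𝟘 : Vtx n
𝟘 = replicate _ false

⊕-assoc : (x y z : Vtx n) → (x ⊕ y) ⊕ z ≡ x ⊕ (y ⊕ z)
⊕-assoc = Vec.zipWith-assoc 𝔹.xor-assoc

⊕-comm : (x y : Vtx n) → x ⊕ y ≡ y ⊕ x
⊕-comm = Vec.zipWith-comm 𝔹.xor-comm

⊕-identityˡ : (x : Vtx n) → 𝟘 ⊕ x ≡ x
⊕-identityˡ = Vec.zipWith-identityˡ 𝔹.xor-identityˡ

⊕-identityʳ : (x : Vtx n) → x ⊕ 𝟘 ≡ x
⊕-identityʳ = Vec.zipWith-identityʳ 𝔹.xor-identityʳ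

⊕-self : (x : Vtx n) → x ⊕ x ≡ 𝟘
⊕-self []      = refl
⊕-self (b ∷ x) = cong₂ _∷_ (𝔹.xor-same b) (⊕-self x)

⊕-cancel : (x y : Vtx n) → x ⊕ (x ⊕ y) ≡ y
⊕-cancel x y = trans (sym (⊕-assoc x x y)) (trans (cong (_⊕ y) (⊕-self x)) (⊕-identityˡ y))

⊕-cancelʳ : (x y : Vtx n) → (x ⊕ y) ⊕ y ≡ x
⊕-cancelʳ x y = trans (⊕-assoc x y y) (trans (cong (x ⊕_) (⊕-self y)) (⊕-identityʳ x))

⊕-cancel-swap : (x y z : Vtx n) → (y ⊕ x) ⊕ (x ⊕ z) ≡ y ⊕ z
⊕-cancel-swap x y z = trans (⊕-assoc y x (x ⊕ z)) (cong (y ⊕_) (⊕-cancel x z))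

⊕-cancel-common : (x y z : Vtx n) → (x ⊕ y) ⊕ (x ⊕ z) ≡ y ⊕ z
⊕-cancel-common x y z = trans (cong (_⊕ (x ⊕ z)) (⊕-comm x y)) (⊕-cancel-swap x y z)

⊕-injective : (x : Vtx n) {y z : Vtx n} → x ⊕ y ≡ x ⊕ z → y ≡ z
⊕-injective x {y} {z} eq = trans (sym (⊕-cancel x y)) (trans (cong (x ⊕_) eq) (⊕-cancel x z))

weight-𝟘 : ∀ n → weight (𝟘 {n}) ≡ 0
weight-𝟘 zero    = refl
weight-𝟘 (suc n) = weight-𝟘 n

weight≡0⇒𝟘 : (x : Vtx n) → weight x ≡ 0 → x ≡ 𝟘
weight≡0⇒𝟘 []          _  = refl
weight≡0⇒𝟘 (false ∷ x) eq = cong (false ∷_) (weight≡0⇒𝟘 x eq)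

weight-⊕-≤ : (x y : Vtx n) → weight (x ⊕ y) ≤ weight x + weight y
weight-⊕-≤ []          []          = z≤n
weight-⊕-≤ (false ∷ x) (false ∷ y) = weight-⊕-≤ x y
weight-⊕-≤ (false ∷ x) (true ∷ y)  =
  subst (suc (weight (x ⊕ y)) ≤_) (sym (ℕ.+-suc (weight x) (weight y))) (s≤s (weight-⊕-≤ x y))
weight-⊕-≤ (true ∷ x)  (false ∷ y) = s≤s (weight-⊕-≤ x y)
weight-⊕-≤ (true ∷ x)  (true ∷ y)  = ℕ.m≤n⇒m≤1+n
  (ℕ.≤-trans (weight-⊕-≤ x y) (ℕ.+-monoʳ-≤ (weight x) (ℕ.n≤1+n (weight y))))

dist-self : (x : Vtx n) → dist x x ≡ 0
dist-self {n} x = trans (cong weight (⊕-self x)) (weight-𝟘 n)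

dist-sym : (x y : Vtx n) → dist x y ≡ dist y x
dist-sym x y = cong weight (⊕-comm x y)

dist≡0⇒≡ : (x y : Vtx n) → dist x y ≡ 0 → x ≡ y
dist≡0⇒≡ x y eq = sym (⊕-injective x (begin
  x ⊕ y ≡⟨ weight≡0⇒𝟘 (x ⊕ y) eq ⟩
  𝟘     ≡⟨ ⊕-self x ⟨
  x ⊕ x ∎))
  where open ≡-Reasoning

dist-triangle : (x y z : Vtx n) → dist x z ≤ dist x y + dist y z
dist-triangle x y z =
  subst (λ w → weight w ≤ dist x y + dist y z) (⊕-cancel-swap y x z) (weight-⊕-≤ (x ⊕ y) (y ⊕ z))

dist-translate : (x y z : Vtx n) → dist (x ⊕ y) (x ⊕ z) ≡ dist y z
dist-translate x y z = cong weight (⊕-cancel-common x y z)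

dist-shift : (x z : Vtx n) → dist x (x ⊕ z) ≡ weight z
dist-shift x z = cong weight (⊕-cancel x z)

-- Parity of the weight as an additive map to F₂.

parity : Vtx n → Bool
parity []      = false
parity (b ∷ x) = b xor parity x

odd : ℕ → Bool
odd zero    = false
odd (suc m) = true xor odd m

parity-weight : (x : Vtx n) → parity x ≡ odd (weight x)
parity-weight []          = refl
parity-weight (true ∷ x)  = cong (true xor_) (parity-weight x)
parity-weight (false ∷ x) = parity-weight x

xor-interchange : ∀ a b c d → (a xor b) xor (c xor d) ≡ (a xor c) xor (b xor d)
xor-interchange = CommutativeSemigroupProperties.interchange
  (CommutativeMonoid.commutativeSemigroup (CommutativeRing.+-commutativeMonoid 𝔹.xor-∧-commutativeRing))

parity-⊕ : (x y : Vtx n) → parity (x ⊕ y) ≡ parity x xor parity y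
parity-⊕ []      []      = refl
parity-⊕ (a ∷ x) (b ∷ y) =
  trans (cong ((a xor b) xor_) (parity-⊕ x y)) (xor-interchange a b (parity x) (parity y))

Even⇒odd≡false : ∀ {m} → Even m → odd m ≡ false
Even⇒odd≡false ev0      = refl
Even⇒odd≡false (ev+2 p) = trans (𝔹.not-involutive _) (Even⇒odd≡false p)

odd≡false⇒Even : ∀ m → odd m ≡ false → Even m
odd≡false⇒Even zero          _  = ev0
odd≡false⇒Even (suc (suc m)) eq =
  ev+2 (odd≡false⇒Even m (trans (sym (𝔹.not-involutive _)) eq))

InE⇒parity : (x : Vtx n) → InE x → parity x ≡ false
InE⇒parity x p = trans (parity-weight x) (Even⇒odd≡false p)

parity⇒InE : (x : Vtx n) → parity x ≡ false → InE x
parity⇒InE x eq = odd≡false⇒Even (weight x) (trans (sym (parity-weight x)) eq)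

parity-dist : (x y : Vtx n) → parity x xor parity y ≡ odd (dist x y)
parity-dist x y = trans (sym (parity-⊕ x y)) (parity-weight (x ⊕ y))

-- Unit vectors, pairs of coordinates and induction over even vectors.

e : Fin n → Vtx n
e zero    = true ∷ 𝟘
e (suc i) = false ∷ e i

lookup-𝟘 : (i : Fin n) → lookup 𝟘 i ≡ false
lookup-𝟘 i = Vec.lookup-replicate i false

lookup-e-≡ : (i : Fin n) → lookup (e i) i ≡ true
lookup-e-≡ zero    = refl
lookup-e-≡ (suc i) = lookup-e-≡ i

lookup-e-≢ : (i j : Fin n) → i ≢ j → lookup (e i) j ≡ false
lookup-e-≢ zero    zero    i≢j = ⊥-elim (i≢j refl)
lookup-e-≢ zero    (suc j) _   = lookup-𝟘 j
lookup-e-≢ (suc i) zero    _   = refl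
lookup-e-≢ (suc i) (suc j) i≢j = lookup-e-≢ i j (i≢j ∘ cong suc)

lookup-e-true : (i j : Fin n) → lookup (e i) j ≡ true → i ≡ j
lookup-e-true i j eq with i F.≟ j
... | yes i≡j = i≡j
... | no  i≢j with () ← trans (sym eq) (lookup-e-≢ i j i≢j)

lookup-⊕ : (x y : Vtx n) (i : Fin n) → lookup (x ⊕ y) i ≡ lookup x i xor lookup y i
lookup-⊕ x y i = Vec.lookup-zipWith _xor_ i x y

weight-e⊕ : (i : Fin n) (x : Vtx n) → lookup x i ≡ false → weight (e i ⊕ x) ≡ suc (weight x)
weight-e⊕ zero    (false ∷ x) _  = cong (suc ∘ weight) (⊕-identityˡ x)
weight-e⊕ (suc i) (false ∷ x) eq = weight-e⊕ i x eq
weight-e⊕ (suc i) (true ∷ x)  eq = cong suc (weight-e⊕ i x eq)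

weight-e : (i : Fin n) → weight (e i) ≡ 1
weight-e {suc n} zero = cong suc (weight-𝟘 n)
weight-e (suc i) = weight-e i

weight-e⊕e : (i j : Fin n) → i ≢ j → weight (e i ⊕ e j) ≡ 2
weight-e⊕e i j i≢j =
  trans (weight-e⊕ i (e j) (lookup-e-≢ j i (i≢j ∘ sym))) (cong suc (weight-e j))

lookup-e⊕e-≢ : (i j k : Fin n) → i ≢ k → j ≢ k → lookup (e i ⊕ e j) k ≡ false
lookup-e⊕e-≢ i j k i≢k j≢k =
  trans (lookup-⊕ (e i) (e j) k) (cong₂ _xor_ (lookup-e-≢ i k i≢k) (lookup-e-≢ j k j≢k))

dist-disjoint-pairs : (i j k l : Fin n) → i ≢ j → k ≢ l → i ≢ k → i ≢ l → j ≢ k → j ≢ l →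
                      dist (e i ⊕ e j) (e k ⊕ e l) ≡ 4
dist-disjoint-pairs i j k l i≢j k≢l i≢k i≢l j≢k j≢l = begin
  weight ((e i ⊕ e j) ⊕ (e k ⊕ e l)) ≡⟨ cong weight (⊕-assoc (e i) (e j) _) ⟩
  weight (e i ⊕ (e j ⊕ (e k ⊕ e l))) ≡⟨ weight-e⊕ i _ (trans (lookup-⊕ (e j) _ i)
      (cong₂ _xor_ (lookup-e-≢ j i (i≢j ∘ sym)) (lookup-e⊕e-≢ k l i (i≢k ∘ sym) (i≢l ∘ sym)))) ⟩
  suc (weight (e j ⊕ (e k ⊕ e l)))
    ≡⟨ cong suc (weight-e⊕ j _ (lookup-e⊕e-≢ k l j (j≢k ∘ sym) (j≢l ∘ sym))) ⟩
  suc (suc (weight (e k ⊕ e l))) ≡⟨ cong (2 +_) (weight-e⊕e k l k≢l) ⟩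
  4 ∎
  where open ≡-Reasoning

dist-meeting-pairs : (i j k : Fin n) → j ≢ k → dist (e i ⊕ e j) (e i ⊕ e k) ≡ 2
dist-meeting-pairs i j k j≢k = trans (dist-translate (e i) (e j) (e k)) (weight-e⊕e j k j≢k)

split-weight : ∀ {m} (x : Vtx n) → weight x ≡ suc m →
               ∃[ i ] ∃[ y ] (x ≡ e i ⊕ y × lookup y i ≡ false × weight y ≡ m)
split-weight (true ∷ x)  eq = zero , false ∷ x , cong (true ∷_) (sym (⊕-identityˡ x)) , refl ,
                              ℕ.suc-injective eq
split-weight (false ∷ x) eq with i , y , p , q , r ← split-weight x eq =
  suc i , false ∷ y , cong (false ∷_) p , q , r

split-weight-2 : ∀ {m} (x : Vtx n) → weight x ≡ 2 + m →
                 ∃[ i ] ∃[ j ] ∃[ y ] (i ≢ j × x ≡ (e i ⊕ e j) ⊕ y × weight y ≡ m)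
split-weight-2 x eq with split-weight x eq
... | i , y , x≡ , yi , wy with split-weight y wy
... | j , z , y≡ , zj , wz =
  i , j , z , i≢j , trans x≡ (trans (cong (e i ⊕_) y≡) (sym (⊕-assoc (e i) (e j) z))) , wz
  where
  -- The remainder y contains j but not i, which keeps the two coordinates distinct.
  yj : lookup y j ≡ true
  yj = trans (cong (λ v → lookup v j) y≡)
         (trans (lookup-⊕ (e j) z j) (cong₂ _xor_ (lookup-e-≡ j) zj))
  i≢j : i ≢ j
  i≢j refl with () ← trans (sym yi) yj

weight≡2⇒pair : (x : Vtx n) → weight x ≡ 2 → ∃[ i ] ∃[ j ] (i ≢ j × x ≡ e i ⊕ e j)
weight≡2⇒pair x eq with split-weight-2 x eq
... | i , j , y , i≢j , x≡ , wy =
  i , j , i≢j , trans x≡ (trans (cong (_ ⊕_) (weight≡0⇒𝟘 y wy)) (⊕-identityʳ _))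

-- Removing ones two at a time writes a vector of even weight as a sum of vectors of weight 2.
even-induction : (P : Vtx n → Set) → P 𝟘 → (∀ x u → weight u ≡ 2 → P x → P (x ⊕ u)) →
                 ∀ x → parity x ≡ false → P x
even-induction P base step x px = go (weight x) x refl (parity⇒InE x px)
  where
  go : ∀ m x → weight x ≡ m → Even m → P x
  go .0 x eq ev0 = subst P (sym (weight≡0⇒𝟘 x eq)) base
  go .(suc (suc _)) x eq (ev+2 {m} ev) with split-weight-2 x eq
  ... | i , j , y , i≢j , x≡ , wy =
    subst P (trans (⊕-comm y _) (sym x≡)) (step y _ (weight-e⊕e i j i≢j) (go m y wy ev))

-- Pigeonhole arguments on finite index sets.

fresh : (xs : List (Fin n)) → length xs < n → ∃[ i ] i ∉ xs
fresh {n} xs l<n with F.any? (λ i → ¬? (DecMembership._∈?_ F._≟_ i xs))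
... | yes found = found
-- If every index occurred in `xs`, its position there would inject `Fin n` into a smaller set.
... | no  none  = ⊥-elim (F.<⇒notInjective l<n index-injective)
  where
  open DecMembership F._≟_ using (_∈?_)
  mem : ∀ i → i ∈ xs
  mem i = decidable-stable (i ∈? xs) (λ i∉ → none (i , i∉))
  index-injective : ∀ {i j} → index (mem i) ≡ index (mem j) → i ≡ j
  index-injective {i} {j} eq = trans (Any.lookup-index (mem i))
    (trans (cong (List.lookup xs) eq) (sym (Any.lookup-index (mem j))))

injective⇒permutation : (f : Fin n → Fin n) → (∀ i j → f i ≡ f j → i ≡ j) →
                        ∃[ σ ] (∀ i → σ ⟨$⟩ʳ i ≡ f i)
injective⇒permutation {n} f inj = permutation f g fg (λ i → inj _ _ (fg (f i))) , λ _ → refl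
  where
  -- If j were missed, punching it out would leave an injection of `Fin (suc n)` into `Fin n`.
  preimage : ∀ {n} (f : Fin n → Fin n) → (∀ i j → f i ≡ f j → i ≡ j) → ∀ j → ∃[ i ] f i ≡ j
  preimage {suc n} f inj j with F.any? (λ i → f i F.≟ j)
  ... | yes found = found
  ... | no  none  = ⊥-elim (F.<⇒notInjective {f = λ i → punchOut {i = j} (λ eq → none (i , sym eq))}
                      (ℕ.n<1+n n) (λ {i} {k} eq → inj i k (F.punchOut-injective {i = j} _ _ eq)))
  g : Fin n → Fin n
  g j = proj₁ (preimage f inj j)
  fg : ∀ j → f (g j) ≡ j
  fg j = proj₂ (preimage f inj j)

-- Coordinate permutations and the affine action on the cube.

module ℕSum = Sum ℕ.+-0-commutativeMonoid

bit : Bool → ℕ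
bit true  = 1
bit false = 0

-- Reduces the invariance of weight under coordinate permutations to reindexing a finite sum.
weight-as-sum : (x : Vtx n) → weight x ≡ ℕSum.sum (λ i → bit (lookup x i))
weight-as-sum []          = refl
weight-as-sum (true ∷ x)  = cong suc (weight-as-sum x)
weight-as-sum (false ∷ x) = weight-as-sum x

vec-ext : (x y : Vtx n) → (∀ i → lookup x i ≡ lookup y i) → x ≡ y
vec-ext x y eq =
  trans (sym (Vec.tabulate∘lookup x)) (trans (Vec.tabulate-cong eq) (Vec.tabulate∘lookup y))

lookup-permute : (σ : Permutation′ n) (z : Vtx n) (j : Fin n) →
                 lookup (permute σ z) j ≡ lookup z (σ ⟨$⟩ˡ j)
lookup-permute σ z = Vec.lookup∘tabulate (λ j → lookup z (σ ⟨$⟩ˡ j))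

weight-permute : (σ : Permutation′ n) (z : Vtx n) → weight (permute σ z) ≡ weight z
weight-permute σ z = begin
  weight (permute σ z)                           ≡⟨ weight-as-sum (permute σ z) ⟩
  ℕSum.sum (λ j → bit (lookup (permute σ z) j))  ≡⟨ ℕSum.sum-cong-≗ (cong bit ∘ lookup-permute σ z) ⟩
  -- `permute σ` reads coordinates through the inverse of σ, so the sum is reindexed along `flip σ`.
  ℕSum.sum (λ j → bit (lookup z (σ ⟨$⟩ˡ j)))     ≡⟨ ℕSum.sum-permute (bit ∘ lookup z) (flip σ) ⟨
  ℕSum.sum (λ i → bit (lookup z i))              ≡⟨ weight-as-sum z ⟨
  weight z                                       ∎
  where open ≡-Reasoning

permute-⊕ : (σ : Permutation′ n) (x y : Vtx n) → permute σ (x ⊕ y) ≡ permute σ x ⊕ permute σ y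
permute-⊕ σ x y = vec-ext _ _ λ j → begin
  lookup (permute σ (x ⊕ y)) j                       ≡⟨ lookup-permute σ (x ⊕ y) j ⟩
  lookup (x ⊕ y) (σ ⟨$⟩ˡ j)                          ≡⟨ lookup-⊕ x y _ ⟩
  lookup x (σ ⟨$⟩ˡ j) xor lookup y (σ ⟨$⟩ˡ j)        ≡⟨ cong₂ _xor_ (lookup-permute σ x j) (lookup-permute σ y j) ⟨
  lookup (permute σ x) j xor lookup (permute σ y) j  ≡⟨ lookup-⊕ (permute σ x) (permute σ y) j ⟨
  lookup (permute σ x ⊕ permute σ y) j               ∎
  where open ≡-Reasoning

permute-𝟘 : (σ : Permutation′ n) → permute σ 𝟘 ≡ 𝟘
permute-𝟘 σ = vec-ext _ _ λ j →
  trans (lookup-permute σ 𝟘 j) (trans (lookup-𝟘 (σ ⟨$⟩ˡ j)) (sym (lookup-𝟘 j)))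

permute-e : (σ : Permutation′ n) (i : Fin n) → permute σ (e i) ≡ e (σ ⟨$⟩ʳ i)
permute-e σ i = vec-ext _ _ λ j → trans (lookup-permute σ (e i) j) (at j)
  where
  at : ∀ j → lookup (e i) (σ ⟨$⟩ˡ j) ≡ lookup (e (σ ⟨$⟩ʳ i)) j
  at j with i F.≟ σ ⟨$⟩ˡ j
  ... | yes refl = trans (lookup-e-≡ i)
                     (sym (trans (cong (λ k → lookup (e k) j) (inverseʳ σ)) (lookup-e-≡ j)))
  ... | no  i≢   = trans (lookup-e-≢ i _ i≢)
                     (sym (lookup-e-≢ _ j λ eq → i≢ (trans (sym (inverseˡ σ)) (cong (σ ⟨$⟩ˡ_) eq))))

permute-flip : (σ : Permutation′ n) (z : Vtx n) → permute (flip σ) (permute σ z) ≡ z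
permute-flip σ z = vec-ext _ _ λ j → trans (lookup-permute (flip σ) (permute σ z) j)
  (trans (lookup-permute σ z (σ ⟨$⟩ʳ j)) (cong (lookup z) (inverseˡ σ)))

permute-∘ : (σ τ : Permutation′ n) (z : Vtx n) → permute (σ ∘ₚ τ) z ≡ permute τ (permute σ z)
permute-∘ σ τ z = vec-ext _ _ λ j → trans (lookup-permute (σ ∘ₚ τ) z j)
  (sym (trans (lookup-permute τ (permute σ z) j) (lookup-permute σ z (τ ⟨$⟩ˡ j))))

-- The translation is absorbed by the image of x, so g is affine with linear part
-- `permute (proj₂ g)`.
act-⊕ : (g : AutQ n) (x z : Vtx n) → act g (x ⊕ z) ≡ act g x ⊕ permute (proj₂ g) z
act-⊕ (a , σ) x z = begin
  permute σ ((x ⊕ z) ⊕ a)            ≡⟨ cong (permute σ) (⊕-assoc x z a) ⟩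
  permute σ (x ⊕ (z ⊕ a))            ≡⟨ cong (permute σ ∘ (x ⊕_)) (⊕-comm z a) ⟩
  permute σ (x ⊕ (a ⊕ z))            ≡⟨ cong (permute σ) (⊕-assoc x a z) ⟨
  permute σ ((x ⊕ a) ⊕ z)            ≡⟨ permute-⊕ σ (x ⊕ a) z ⟩
  permute σ (x ⊕ a) ⊕ permute σ z    ∎
  where open ≡-Reasoning

dist-act : (g : AutQ n) (x y : Vtx n) → dist (act g x) (act g y) ≡ dist x y
dist-act g x y = begin
  dist (act g x) (act g y)            ≡⟨ cong (dist (act g x) ∘ act g) (⊕-cancel x y) ⟨
  dist (act g x) (act g (x ⊕ (x ⊕ y))) ≡⟨ cong (dist (act g x)) (act-⊕ g x (x ⊕ y)) ⟩
  dist (act g x) (act g x ⊕ permute (proj₂ g) (x ⊕ y)) ≡⟨ dist-shift (act g x) _ ⟩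
  weight (permute (proj₂ g) (x ⊕ y))  ≡⟨ weight-permute (proj₂ g) (x ⊕ y) ⟩
  dist x y                            ∎
  where open ≡-Reasoning

act-injective : (g : AutQ n) {x y : Vtx n} → act g x ≡ act g y → x ≡ y
act-injective g {x} {y} eq = dist≡0⇒≡ x y
  (trans (sym (dist-act g x y)) (trans (cong (dist (act g x)) (sym eq)) (dist-self (act g x))))

parity-permute : (σ : Permutation′ n) (z : Vtx n) → parity (permute σ z) ≡ parity z
parity-permute σ z = trans (parity-weight (permute σ z))
  (trans (cong odd (weight-permute σ z)) (sym (parity-weight z)))

parity-act : (g : AutQ n) (x : Vtx n) → parity (act g x) ≡ parity x xor parity (proj₁ g)
parity-act (a , σ) x = trans (parity-permute σ (x ⊕ a)) (parity-⊕ x a)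

parity-act-even : (g : AutQ n) → InES g → ∀ x → parity (act g x) ≡ parity x
parity-act-even g ev x = trans (parity-act g x)
  (trans (cong (parity x xor_) (InE⇒parity (proj₁ g) ev)) (𝔹.xor-identityʳ _))

-- Inverses, products and prescribed affine maps.

infix 8 _⁻¹
-- Solving y = (x + a)^σ for x and moving a inside the inverse permutation turns it into a^σ.
_⁻¹ : AutQ n → AutQ n
(a , σ) ⁻¹ = permute σ a , flip σ

act-⁻¹-act : (g : AutQ n) (x : Vtx n) → act (g ⁻¹) (act g x) ≡ x
act-⁻¹-act (a , σ) x = begin
  permute (flip σ) (permute σ (x ⊕ a) ⊕ permute σ a) ≡⟨ cong (permute (flip σ)) (permute-⊕ σ (x ⊕ a) a) ⟨
  permute (flip σ) (permute σ ((x ⊕ a) ⊕ a))         ≡⟨ permute-flip σ _ ⟩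
  (x ⊕ a) ⊕ a                                        ≡⟨ ⊕-cancelʳ x a ⟩
  x                                                  ∎
  where open ≡-Reasoning

act-act-⁻¹ : (g : AutQ n) (x : Vtx n) → act g (act (g ⁻¹) x) ≡ x
act-act-⁻¹ g x = act-injective (g ⁻¹) (act-⁻¹-act g (act (g ⁻¹) x))

parity-preimage : (g : AutQ n) → InES g → ∀ y → parity (act (g ⁻¹) y) ≡ parity y
parity-preimage g ev y =
  trans (sym (parity-act-even g ev (act (g ⁻¹) y))) (cong parity (act-act-⁻¹ g y))

-- Since the action is on the right, g ∙ h acts by g first.
infixl 7 _∙_
_∙_ : AutQ n → AutQ n → AutQ n
(a , σ) ∙ (b , τ) = a ⊕ permute (flip σ) b , σ ∘ₚ τ

act-∙ : (g h : AutQ n) (x : Vtx n) → act (g ∙ h) x ≡ act h (act g x)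
act-∙ (a , σ) (b , τ) x = begin
  permute (σ ∘ₚ τ) (x ⊕ (a ⊕ permute (flip σ) b))         ≡⟨ permute-∘ σ τ (x ⊕ (a ⊕ permute (flip σ) b)) ⟩
  permute τ (permute σ (x ⊕ (a ⊕ permute (flip σ) b)))     ≡⟨ cong (permute τ ∘ permute σ) (⊕-assoc x a _) ⟨
  permute τ (permute σ ((x ⊕ a) ⊕ permute (flip σ) b))     ≡⟨ cong (permute τ) (permute-⊕ σ (x ⊕ a) _) ⟩
  permute τ (permute σ (x ⊕ a) ⊕ permute σ (permute (flip σ) b))
    ≡⟨ cong (λ c → permute τ (permute σ (x ⊕ a) ⊕ c)) (permute-flip (flip σ) b) ⟩
  permute τ (permute σ (x ⊕ a) ⊕ b)                        ∎
  where open ≡-Reasoning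

affine : (x y : Vtx n) (σ : Permutation′ n) → ∃[ g ] (proj₂ g ≡ σ × act g x ≡ y)
affine x y σ = (x ⊕ permute (flip σ) y , σ) , refl ,
  trans (cong (permute σ) (⊕-cancel x _)) (permute-flip (flip σ) y)

-- The triangular graph T(n) and its automorphisms.

meeting-pair : (s p : Fin n) → s ≢ p → (w : Vtx n) → weight w ≡ 2 → dist w (e s ⊕ e p) ≡ 2 →
               ∃[ r ] (r ≢ s × r ≢ p × (w ≡ e s ⊕ e r ⊎ w ≡ e p ⊕ e r))
meeting-pair s p s≢p w ww d with weight≡2⇒pair w ww
... | c , d' , c≢d , refl = go (c F.≟ s) (c F.≟ p) (d' F.≟ s) (d' F.≟ p)
  where
  same : ¬ dist (e s ⊕ e p) (e s ⊕ e p) ≡ 2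
  same eq with () ← trans (sym eq) (dist-self (e s ⊕ e p))
  -- Equal pairs are at distance 0 and disjoint pairs at distance 4, so w shares exactly one end
  -- with {s, p}; r is its other end.
  go : Dec (c ≡ s) → Dec (c ≡ p) → Dec (d' ≡ s) → Dec (d' ≡ p) →
       ∃[ r ] (r ≢ s × r ≢ p × (e c ⊕ e d' ≡ e s ⊕ e r ⊎ e c ⊕ e d' ≡ e p ⊕ e r))
  go (yes refl) _ _ (yes refl) = ⊥-elim (same d)
  go (yes refl) _ _ (no d≢p)   = d' , c≢d ∘ sym , d≢p , inj₁ refl
  go _ (yes refl) (yes refl) _ = ⊥-elim (same (trans
    (cong (λ v → weight (v ⊕ (e s ⊕ e p))) (⊕-comm (e s) (e p))) d))
  go _ (yes refl) (no d≢s) _   = d' , d≢s , c≢d ∘ sym , inj₂ refl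
  go (no c≢s) (no c≢p) (yes refl) _ = c , c≢s , c≢p , inj₁ (⊕-comm (e c) (e d'))
  go (no c≢s) (no c≢p) _ (yes refl) = c , c≢s , c≢p , inj₂ (⊕-comm (e c) (e d'))
  go (no c≢s) (no c≢p) (no d≢s) (no d≢p)
    with () ← trans (sym d) (dist-disjoint-pairs c d' s p c≢d s≢p c≢s c≢p d≢s d≢p)

-- A pair avoiding s can meet {s, p} only in p and {s, q} only in q.
star-or-triangle : (s p q : Fin n) → s ≢ p → s ≢ q → p ≢ q → (w : Vtx n) → weight w ≡ 2 →
                   dist w (e s ⊕ e p) ≡ 2 → dist w (e s ⊕ e q) ≡ 2 →
                   (∃[ r ] (r ≢ s × r ≢ p × w ≡ e s ⊕ e r)) ⊎ w ≡ e p ⊕ e q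
star-or-triangle s p q s≢p s≢q p≢q w ww d₁ d₂ with meeting-pair s p s≢p w ww d₁
... | r , r≢s , r≢p , inj₁ eq   = inj₁ (r , r≢s , r≢p , eq)
... | r , r≢s , r≢p , inj₂ refl with r F.≟ q
... | yes refl = inj₂ refl
... | no  r≢q
  with () ← trans (sym d₂) (dist-disjoint-pairs p r s q (r≢p ∘ sym) s≢q (s≢p ∘ sym) p≢q r≢s r≢q)

-- A pair that meets all three sides of a triangle is one of the sides, hence at distance 0 from
-- that side.
no-fourth-edge : (s p q : Fin n) → s ≢ p → s ≢ q → p ≢ q → (w : Vtx n) → weight w ≡ 2 →
                 dist w (e s ⊕ e p) ≡ 2 → dist w (e s ⊕ e q) ≡ 2 → dist w (e p ⊕ e q) ≢ 2
no-fourth-edge s p q s≢p s≢q p≢q w ww d₁ d₂ d₃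
  with star-or-triangle s p q s≢p s≢q p≢q w ww d₁ d₂
... | inj₂ refl with () ← trans (sym d₃) (dist-self w)
no-fourth-edge s p q s≢p s≢q p≢q w ww d₁ d₂ d₃ | inj₁ (r , r≢s , r≢p , refl) with r F.≟ q
... | yes refl with () ← trans (sym d₂) (dist-self w)
... | no  r≢q
  with () ← trans (sym d₃) (dist-disjoint-pairs s r p q (r≢s ∘ sym) p≢q s≢p s≢q r≢p r≢q)

-- Vectors of weight 2 are the vertices of T(n).  The n-1 ≥ 4 vertices e i ⊕ e c of the clique at i
-- are sent to pairwise meeting pairs, too many to lie in a triangle, so the images share a point.
module Triangular (5≤n : 5 ≤ n) (F : Vtx n → Vtx n)
  (weight-F  : ∀ z → weight z ≡ 2 → weight (F z) ≡ 2)
  (adjacent  : ∀ z z' → weight z ≡ 2 → weight z' ≡ 2 → dist z z' ≡ 2 → dist (F z) (F z') ≡ 2)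
  (reflected : ∀ z z' → weight z ≡ 2 → weight z' ≡ 2 → dist (F z) (F z') ≤ 2 → dist z z' ≤ 2)
  where

  Centre : Fin n → Fin n → Set
  Centre i s = ∀ c → i ≢ c → ∃[ r ] (r ≢ s × F (e i ⊕ e c) ≡ e s ⊕ e r)

  adjacent-star : ∀ i a b → i ≢ a → i ≢ b → a ≢ b → dist (F (e i ⊕ e a)) (F (e i ⊕ e b)) ≡ 2
  adjacent-star i a b i≢a i≢b a≢b =
    adjacent _ _ (weight-e⊕e i a i≢a) (weight-e⊕e i b i≢b) (dist-meeting-pairs i a b a≢b)

  -- Two images single out s. A third image avoiding s would close a triangle with them, and the
  -- image of a further pair through i would have to meet all three sides.
  centre-from-two : ∀ i a b → i ≢ a → i ≢ b → a ≢ b → ∀ s p q → s ≢ p → s ≢ q → p ≢ q →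
                    F (e i ⊕ e a) ≡ e s ⊕ e p → F (e i ⊕ e b) ≡ e s ⊕ e q → Centre i s
  centre-from-two i a b i≢a i≢b a≢b s p q s≢p s≢q p≢q Fa Fb c i≢c
    with c F.≟ a | c F.≟ b
  ... | yes refl | _        = p , s≢p ∘ sym , Fa
  ... | no _     | yes refl = q , s≢q ∘ sym , Fb
  ... | no c≢a   | no c≢b
    with star-or-triangle s p q s≢p s≢q p≢q (F (e i ⊕ e c)) (weight-F _ (weight-e⊕e i c i≢c))
           (trans (cong (dist (F (e i ⊕ e c))) (sym Fa)) (adjacent-star i c a i≢c i≢a c≢a))
           (trans (cong (dist (F (e i ⊕ e c))) (sym Fb)) (adjacent-star i c b i≢c i≢b c≢b))
  ... | inj₁ (r , r≢s , _ , eq) = r , r≢s , eq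
  -- Four indices have to be avoided, hence n ≥ 5. For n = 4, taking complements of pairs is an
  -- automorphism that carries stars to triangles.
  ... | inj₂ Fc with fresh (i ∷ a ∷ b ∷ c ∷ []) 5≤n
  ... | d , d∉ = ⊥-elim (no-fourth-edge s p q s≢p s≢q p≢q (F (e i ⊕ e d))
        (weight-F _ (weight-e⊕e i d i≢d))
        (trans (cong (dist (F (e i ⊕ e d))) (sym Fa))
          (adjacent-star i d a i≢d i≢a λ { refl → d∉ (there (here refl)) }))
        (trans (cong (dist (F (e i ⊕ e d))) (sym Fb))
          (adjacent-star i d b i≢d i≢b λ { refl → d∉ (there (there (here refl))) }))
        (trans (cong (dist (F (e i ⊕ e d))) (sym Fc))
          (adjacent-star i d c i≢d i≢c λ { refl → d∉ (there (there (there (here refl)))) })))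
    where
    i≢d : i ≢ d
    i≢d refl = d∉ (here refl)

  -- The images of two pairs through i share one point. The two cases of `go` are the two ends of
  -- the first image that it can be.
  centre : ∀ i → ∃[ s ] Centre i s
  centre i with fresh (i ∷ []) (ℕ.≤-trans (s≤s (s≤s z≤n)) 5≤n)
  ... | a , a∉ with fresh (i ∷ a ∷ []) (ℕ.≤-trans (s≤s (s≤s (s≤s z≤n))) 5≤n)
  ... | b , b∉ = go (weight≡2⇒pair (F (e i ⊕ e a)) (weight-F _ (weight-e⊕e i a i≢a)))
    where
    i≢a : i ≢ a
    i≢a refl = a∉ (here refl)
    i≢b : i ≢ b
    i≢b refl = b∉ (here refl)
    a≢b : a ≢ b
    a≢b refl = b∉ (there (here refl))
    go : ∃[ c ] ∃[ d ] (c ≢ d × F (e i ⊕ e a) ≡ e c ⊕ e d) → ∃[ s ] Centre i s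
    go (c , d , c≢d , Fa)
      with meeting-pair c d c≢d (F (e i ⊕ e b)) (weight-F _ (weight-e⊕e i b i≢b))
             (trans (cong (dist (F (e i ⊕ e b))) (sym Fa)) (adjacent-star i b a i≢b i≢a (a≢b ∘ sym)))
    ... | r , r≢c , r≢d , inj₁ Fb =
      c , centre-from-two i a b i≢a i≢b a≢b c d r c≢d (r≢c ∘ sym) (r≢d ∘ sym) Fa Fb
    ... | r , r≢c , r≢d , inj₂ Fb =
      d , centre-from-two i a b i≢a i≢b a≢b d c r (c≢d ∘ sym) (r≢d ∘ sym) (r≢c ∘ sym)
            (trans Fa (⊕-comm (e c) (e d))) Fb

  -- Only a bound, because the two pairs compared in `s-injective` are not known to differ.
  dist-meeting-≤ : ∀ (i j k : Fin n) → dist (e i ⊕ e j) (e i ⊕ e k) ≤ 2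
  dist-meeting-≤ i j k = subst (_≤ 2) (sym (dist-translate (e i) (e j) (e k)))
    (subst₂ (λ l m → weight (e j ⊕ e k) ≤ l + m) (weight-e j) (weight-e k) (weight-⊕-≤ (e j) (e k)))

  module _ (s : Fin n → Fin n) (centre-s : ∀ i → Centre i (s i)) where

    -- With equal centres, the disjoint pairs {i, a} and {j, b} would have images through a common
    -- point. Then `reflected` would put them within distance 2, whereas they are at distance 4.
    s-injective : ∀ i j → s i ≡ s j → i ≡ j
    s-injective i j si≡sj with i F.≟ j
    ... | yes i≡j = i≡j
    ... | no  i≢j with fresh (i ∷ j ∷ []) (ℕ.≤-trans (s≤s (s≤s (s≤s z≤n))) 5≤n)
    ... | a , a∉ with fresh (i ∷ j ∷ a ∷ []) (ℕ.≤-trans (s≤s (s≤s (s≤s (s≤s z≤n)))) 5≤n)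
    ... | b , b∉ = ⊥-elim (4≰2 (subst (_≤ 2) disjoint
      (reflected _ _ (weight-e⊕e i a i≢a) (weight-e⊕e j b j≢b) close)))
      where
      i≢a : i ≢ a
      i≢a refl = a∉ (here refl)
      j≢a : j ≢ a
      j≢a refl = a∉ (there (here refl))
      i≢b : i ≢ b
      i≢b refl = b∉ (here refl)
      j≢b : j ≢ b
      j≢b refl = b∉ (there (here refl))
      a≢b : a ≢ b
      a≢b refl = b∉ (there (there (here refl)))
      4≰2 : ¬ 4 ≤ 2
      4≰2 (s≤s (s≤s ()))
      disjoint : dist (e i ⊕ e a) (e j ⊕ e b) ≡ 4
      disjoint = dist-disjoint-pairs i a j b i≢a j≢b i≢j i≢b (j≢a ∘ sym) a≢b
      close : dist (F (e i ⊕ e a)) (F (e j ⊕ e b)) ≤ 2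
      close with centre-s i a i≢a | centre-s j b j≢b
      ... | p , _ , Fp | q , _ , Fq = subst₂ (λ v w → dist v w ≤ 2) (sym Fp)
            (trans (cong (λ t → e t ⊕ e q) si≡sj) (sym Fq)) (dist-meeting-≤ (s i) p q)

    -- The image of {i, j} contains both centres, which differ by injectivity. Comparing coordinate
    -- `s j` of the two descriptions of the image shows that the end p is `s j`.
    F-pair : ∀ i j → i ≢ j → F (e i ⊕ e j) ≡ e (s i) ⊕ e (s j)
    F-pair i j i≢j with centre-s i j i≢j | centre-s j i (i≢j ∘ sym)
    ... | p , _ , Fp | q , q≢sj , Fq = trans Fp (cong (λ t → e (s i) ⊕ e t) p≡sj)
      where
      eq : e (s i) ⊕ e p ≡ e (s j) ⊕ e q
      eq = trans (sym Fp) (trans (cong F (⊕-comm (e i) (e j))) Fq)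
      p≡sj : p ≡ s j
      p≡sj = lookup-e-true p (s j) (begin
        lookup (e p) (s j)                              ≡⟨ cong (_xor lookup (e p) (s j))
                                                           (lookup-e-≢ (s i) (s j) (i≢j ∘ s-injective i j)) ⟨
        lookup (e (s i)) (s j) xor lookup (e p) (s j)   ≡⟨ lookup-⊕ (e (s i)) (e p) (s j) ⟨
        lookup (e (s i) ⊕ e p) (s j)                    ≡⟨ cong (λ v → lookup v (s j)) eq ⟩
        lookup (e (s j) ⊕ e q) (s j)                    ≡⟨ lookup-⊕ (e (s j)) (e q) (s j) ⟩
        lookup (e (s j)) (s j) xor lookup (e q) (s j)   ≡⟨ cong₂ _xor_ (lookup-e-≡ (s j)) (lookup-e-≢ q (s j) q≢sj) ⟩
        true                                            ∎)
        where open ≡-Reasoning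

    induced-by-centres : ∃[ σ ] (∀ z → weight z ≡ 2 → F z ≡ permute σ z)
    induced-by-centres with injective⇒permutation s s-injective
    ... | σ , σ≡s = σ , on-pairs
      where
      on-pairs : ∀ z → weight z ≡ 2 → F z ≡ permute σ z
      on-pairs z wz with weight≡2⇒pair z wz
      ... | i , j , i≢j , refl = trans (F-pair i j i≢j) (sym (trans (permute-⊕ σ (e i) (e j))
            (cong₂ _⊕_ (trans (permute-e σ i) (cong e (σ≡s i))) (trans (permute-e σ j) (cong e (σ≡s j))))))

  induced : ∃[ σ ] (∀ z → weight z ≡ 2 → F z ≡ permute σ z)
  induced = induced-by-centres (proj₁ ∘ centre) (proj₂ ∘ centre)

-- If σ and τ differed at i, then for each k ≠ i equality of the images of {i, k} would force σ to
-- send i where τ sends k. Two such k, available for n ≥ 3, contradict the injectivity of τ.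
permute-determined : 3 ≤ n → (σ τ : Permutation′ n) →
                     (∀ z → weight z ≡ 2 → permute σ z ≡ permute τ z) →
                     ∀ z → permute σ z ≡ permute τ z
permute-determined {n} 3≤n σ τ agree z = vec-ext _ _ λ j →
  trans (lookup-permute σ z j) (trans (cong (lookup z) (from≡ j)) (sym (lookup-permute τ z j)))
  where
  hit : ∀ i k → i ≢ k → σ ⟨$⟩ʳ i ≢ τ ⟨$⟩ʳ i → σ ⟨$⟩ʳ i ≡ τ ⟨$⟩ʳ k
  hit i k i≢k ne = sym (lookup-e-true _ _ (begin
    lookup (e τk) σi                       ≡⟨ cong (_xor lookup (e τk) σi) (lookup-e-≢ τi σi (ne ∘ sym)) ⟨
    lookup (e τi) σi xor lookup (e τk) σi  ≡⟨ lookup-⊕ (e τi) (e τk) σi ⟨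
    lookup (e τi ⊕ e τk) σi                ≡⟨ cong (λ v → lookup v σi) images ⟨
    lookup (e σi ⊕ e σk) σi                ≡⟨ lookup-⊕ (e σi) (e σk) σi ⟩
    lookup (e σi) σi xor lookup (e σk) σi  ≡⟨ cong₂ _xor_ (lookup-e-≡ σi) (lookup-e-≢ σk σi σk≢σi) ⟩
    true                                   ∎))
    where
    open ≡-Reasoning
    σi = σ ⟨$⟩ʳ i
    σk = σ ⟨$⟩ʳ k
    τi = τ ⟨$⟩ʳ i
    τk = τ ⟨$⟩ʳ k
    image : ∀ ρ → permute ρ (e i ⊕ e k) ≡ e (ρ ⟨$⟩ʳ i) ⊕ e (ρ ⟨$⟩ʳ k)
    image ρ = trans (permute-⊕ ρ (e i) (e k)) (cong₂ _⊕_ (permute-e ρ i) (permute-e ρ k))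
    images : e σi ⊕ e σk ≡ e τi ⊕ e τk
    images = trans (sym (image σ)) (trans (agree (e i ⊕ e k) (weight-e⊕e i k i≢k)) (image τ))
    σk≢σi : σk ≢ σi
    σk≢σi eq = i≢k (trans (sym (inverseˡ σ)) (trans (cong (σ ⟨$⟩ˡ_) (sym eq)) (inverseˡ σ)))

  to≡ : ∀ i → σ ⟨$⟩ʳ i ≡ τ ⟨$⟩ʳ i
  to≡ i with fresh (i ∷ []) (ℕ.≤-trans (s≤s (s≤s z≤n)) 3≤n)
  ... | j , j∉ with fresh (i ∷ j ∷ []) 3≤n
  ... | k , k∉ = decidable-stable (_ F.≟ _) λ ne → k∉ (there (here (
        trans (sym (inverseˡ τ)) (trans (cong (τ ⟨$⟩ˡ_) (trans
          (sym (hit i k (λ { refl → k∉ (here refl) }) ne))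
          (hit i j (λ { refl → j∉ (here refl) }) ne))) (inverseˡ τ)))))

  from≡ : ∀ j → σ ⟨$⟩ˡ j ≡ τ ⟨$⟩ˡ j
  from≡ j = begin
    σ ⟨$⟩ˡ j                       ≡⟨ inverseˡ τ ⟨
    τ ⟨$⟩ˡ (τ ⟨$⟩ʳ (σ ⟨$⟩ˡ j))     ≡⟨ cong (τ ⟨$⟩ˡ_) (to≡ (σ ⟨$⟩ˡ j)) ⟨
    τ ⟨$⟩ˡ (σ ⟨$⟩ʳ (σ ⟨$⟩ˡ j))     ≡⟨ cong (τ ⟨$⟩ˡ_) (inverseʳ σ) ⟩
    τ ⟨$⟩ˡ j                       ∎
    where open ≡-Reasoning

-- Parity classes of the cube and steps of length 2.

two-steps : (x y z : Vtx n) → dist x y ≡ 1 → dist y z ≡ 1 → x ≢ z → dist x z ≡ 2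
-- The distance is nonzero as x and z differ, at most 2 by the triangle inequality, and even by
-- parity.
two-steps x y z xy yz x≢z = exactly-2 _ (x≢z ∘ dist≡0⇒≡ x z)
    (subst₂ (λ l m → dist x z ≤ l + m) xy yz (dist-triangle x y z)) (begin
  odd (dist x z)                          ≡⟨ parity-weight (x ⊕ z) ⟨
  parity (x ⊕ z)                          ≡⟨ cong parity (⊕-cancel-swap y x z) ⟨
  parity ((x ⊕ y) ⊕ (y ⊕ z))              ≡⟨ parity-⊕ (x ⊕ y) (y ⊕ z) ⟩
  parity (x ⊕ y) xor parity (y ⊕ z)       ≡⟨ cong₂ _xor_ (parity-weight (x ⊕ y)) (parity-weight (y ⊕ z)) ⟩
  odd (dist x y) xor odd (dist y z)       ≡⟨ cong₂ (λ l m → odd l xor odd m) xy yz ⟩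
  false                                   ∎)
  where
  open ≡-Reasoning
  exactly-2 : ∀ m → m ≢ 0 → m ≤ 2 → odd m ≡ false → m ≡ 2
  exactly-2 0 m≢0 _ _ = ⊥-elim (m≢0 refl)
  exactly-2 2 _   _ _ = refl
  exactly-2 (suc (suc (suc m))) _ (s≤s (s≤s ())) _

-- This is `even-induction` translated from 0 to v; the auxiliary `Q` carries the parity along
-- because `step` asks for it.
coset-induction : (v : Vtx n) (P : Vtx n → Set) → P v →
                  (∀ y u → parity y ≡ parity v → weight u ≡ 2 → P y → P (y ⊕ u)) →
                  ∀ y → parity y ≡ parity v → P y
coset-induction v P base step y py =
  subst P (⊕-cancel v y) (proj₂ (even-induction Q Q-base Q-step (v ⊕ y) parity-diff))
  where
  Q : Vtx _ → Set
  Q z = parity z ≡ false × P (v ⊕ z)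
  Q-base : Q 𝟘
  Q-base = trans (cong parity (sym (⊕-self v))) (trans (parity-⊕ v v) (𝔹.xor-same (parity v))) ,
           subst P (sym (⊕-identityʳ v)) base
  Q-step : ∀ x u → weight u ≡ 2 → Q x → Q (x ⊕ u)
  Q-step x u wu (px , Px) =
    trans (parity-⊕ x u) (cong₂ _xor_ px (trans (parity-weight u) (cong odd wu))) ,
    subst P (⊕-assoc v x u) (step (v ⊕ x) u
      (trans (parity-⊕ v x) (trans (cong (parity v xor_) px) (𝔹.xor-identityʳ _))) wu Px)
  parity-diff : parity (v ⊕ y) ≡ false
  parity-diff = trans (parity-⊕ v y) (trans (cong (parity v xor_) py) (𝔹.xor-same (parity v)))

parity-⊕-weight-2 : (y u : Vtx n) → weight u ≡ 2 → parity (y ⊕ u) ≡ parity y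
parity-⊕-weight-2 y u wu = trans (parity-⊕ y u)
  (trans (cong (parity y xor_) (trans (parity-weight u) (cong odd wu))) (𝔹.xor-identityʳ _))

weight-2-dist-≤ : (u w : Vtx n) → weight u ≡ 2 → weight w ≡ 2 → dist u w ≤ 4
weight-2-dist-≤ u w wu ww = subst₂ (λ l m → dist u w ≤ l + m) wu ww (weight-⊕-≤ u w)

-- Orbits, the quotient graph and lifting of short paths.

module Covering {n : ℕ} (K : AutQ n → Set) (K-subgroup : IsSubgroup K) (K-even : IsEvenSub K)
                (K-far : dK≥ 7 K) where

  open Quotient K
  open IsSubgroup K-subgroup

  ∼-setoid : Setoid 0ℓ 0ℓ
  ∼-setoid = record
    { Carrier       = Vtx n
    ; _≈_           = _∼_
    ; isEquivalence = record
      { refl  = λ {x} → reflexive x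
      ; sym   = λ { {x} (k , Kk , refl) → symmetric x k Kk }
      ; trans = λ { {x} (k , Kk , refl) (l , Kl , refl) → transitive x k l Kk Kl }
      }
    }
    where
    reflexive : ∀ x → x ∼ x
    reflexive x with hasId
    ... | k , Kk , k-id = k , Kk , k-id x
    symmetric : ∀ x k → K k → act k x ∼ x
    symmetric x k Kk with closed⁻¹ k Kk
    ... | k' , Kk' , inv = k' , Kk' , inv x
    transitive : ∀ x k l → K k → K l → x ∼ act l (act k x)
    transitive x k l Kk Kl with closed· k l Kk Kl
    ... | m , Km , comp = m , Km , comp x

  module ∼-Reasoning = SetoidReasoning ∼-setoid

  -- The orbit relation unfolds too far for its arguments to be inferred, hence the explicit ones.
  ∼-refl : ∀ x → x ∼ x
  ∼-refl x = Setoid.refl ∼-setoid {x}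

  ∼-sym : ∀ x y → x ∼ y → y ∼ x
  ∼-sym x y = Setoid.sym ∼-setoid {x} {y}

  ∼-trans : ∀ x y z → x ∼ y → y ∼ z → x ∼ z
  ∼-trans x y z = Setoid.trans ∼-setoid {x} {y} {z}

  ∼-parity : ∀ x y → x ∼ y → parity x ≡ parity y
  ∼-parity x _ (k , Kk , refl) = sym (parity-act-even k (K-even k Kk) x)

  -- A non-identity element of K moves every point by at least 7, so one that moves x by at most 6
  -- is the identity.
  ∼-rigid : ∀ x y → x ∼ y → dist x y ≤ 6 → x ≡ y
  ∼-rigid x _ (k , Kk , refl) close = sym (k-id x)
    where
    k-id : IsIdentity k
    -- `K-far` expects a refutation of `IsIdentity k`. Equality of vectors is decidable, so one
    -- supposedly moved point z supplies it.
    k-id z = decidable-stable (Vec.≡-dec 𝔹._≟_ (act k z) z)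
      λ kz≢z → ℕ.<⇒≱ (s≤s close) (K-far k Kk (λ id → kz≢z (id z)) x)

  -- K acts by isometries, so a configuration can be moved to start at any chosen representative of
  -- its first orbit.
  ∼-translate : ∀ x x' → x ∼ x' → ∀ y → ∃[ y' ] (y ∼ y' × dist x' y' ≡ dist x y)
  ∼-translate x _ (k , Kk , refl) y = act k y , (k , Kk , refl) , dist-act k x y

  Adj-lift : ∀ x y → Adj x y → ∃[ y' ] (y ∼ y' × dist x y' ≡ 1)
  Adj-lift x y (_ , x' , y' , x∼x' , y∼y' , d) with ∼-translate x' x (∼-sym x x' x∼x') y'
  ... | y'' , y'∼y'' , d' = y'' , ∼-trans y y' y'' y∼y' y'∼y'' , trans d' d

  -- Since K is even, parity is constant on orbits and gives the bipartition of the quotient.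
  Adj-parity : ∀ x y → Adj x y → parity x xor parity y ≡ true
  Adj-parity x y adj with Adj-lift x y adj
  ... | y' , y∼y' , d = trans (cong (parity x xor_) (∼-parity y y' y∼y'))
        (trans (parity-dist x y') (cong odd d))

  Dist2-parity : ∀ x y → Dist2 x y → parity x ≡ parity y
  Dist2-parity x y (_ , _ , z , xz , zy) =
    same (parity x) (parity z) (parity y) (Adj-parity x z xz) (Adj-parity z y zy)
    where
    same : ∀ a b c → a xor b ≡ true → b xor c ≡ true → a ≡ c
    same true  false true  _ _ = refl
    same false true  false _ _ = refl

  -- Lift the first edge from x and the second from the end of the first. The ends of the lifted
  -- path differ because their orbits do.
  Dist2-lift : ∀ x y → Dist2 x y → ∃[ y' ] (y ∼ y' × dist x y' ≡ 2)
  Dist2-lift x y (x≁y , _ , z , xz , zy) with Adj-lift x z xz | Adj-lift z y zy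
  ... | z₁ , z∼z₁ , d₁ | y₁ , y∼y₁ , d₂ with ∼-translate z z₁ z∼z₁ y₁
  ... | y' , y₁∼y' , d₃ = y' , y∼y' , two-steps x z₁ y' d₁ (trans d₃ d₂)
        λ x≡y' → x≁y (∼-sym y x (subst (y ∼_) (sym x≡y') y∼y'))
    where
    y∼y' : y ∼ y'
    y∼y' = ∼-trans y y₁ y' y∼y₁ y₁∼y'

  near⇒≁ : ∀ x y {m} → dist x y ≡ suc m → suc m ≤ 6 → ¬ x ∼ y
  near⇒≁ x y d small x∼y with ∼-rigid x y x∼y (subst (_≤ 6) (sym d) small)
  ... | refl with () ← trans (sym d) (dist-self x)

  near⇒Adj : ∀ x y → dist x y ≡ 1 → Adj x y
  near⇒Adj x y d = near⇒≁ x y d (s≤s z≤n) , x , y , ∼-refl x , ∼-refl y , d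

  -- Parity rules out adjacency, and flipping one of the two differing coordinates gives an
  -- intermediate vertex.
  near⇒Dist2 : ∀ x y → dist x y ≡ 2 → Dist2 x y
  near⇒Dist2 x y d = near⇒≁ x y d (s≤s (s≤s z≤n)) , not-adjacent , midpoint (weight≡2⇒pair (x ⊕ y) d)
    where
    not-adjacent : ¬ Adj x y
    not-adjacent adj
      with () ← trans (sym (Adj-parity x y adj)) (trans (parity-dist x y) (cong odd d))
    midpoint : ∃[ i ] ∃[ j ] (i ≢ j × x ⊕ y ≡ e i ⊕ e j) → ∃[ z ] (Adj x z × Adj z y)
    midpoint (i , j , _ , eq) = x ⊕ e i , near⇒Adj x (x ⊕ e i) (trans (dist-shift x (e i)) (weight-e i)) ,
      near⇒Adj (x ⊕ e i) y (trans (cong weight (begin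
        (x ⊕ e i) ⊕ y        ≡⟨ cong (_⊕ y) (⊕-comm x (e i)) ⟩
        (e i ⊕ x) ⊕ y        ≡⟨ ⊕-assoc (e i) x y ⟩
        e i ⊕ (x ⊕ y)        ≡⟨ cong (e i ⊕_) eq ⟩
        e i ⊕ (e i ⊕ e j)    ≡⟨ ⊕-cancel (e i) (e j) ⟩
        e j                  ∎)) (weight-e j))
      where open ≡-Reasoning

  ≁-resp : ∀ x x' y y' → x ∼ x' → y ∼ y' → ¬ x ∼ y → ¬ x' ∼ y'
  ≁-resp x x' y y' x∼x' y∼y' x≁y x'∼y' = x≁y (begin
    x   ≈⟨ x∼x' ⟩
    x'  ≈⟨ x'∼y' ⟩
    y'  ≈⟨ y∼y' ⟨
    y   ∎)
    where open ∼-Reasoning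

  Adj-resp : ∀ x x' y y' → x ∼ x' → y ∼ y' → Adj x y → Adj x' y'
  Adj-resp x x' y y' x∼x' y∼y' (x≁y , x₁ , y₁ , x∼x₁ , y∼y₁ , d) =
    ≁-resp x x' y y' x∼x' y∼y' x≁y ,
    x₁ , y₁ , ∼-trans x' x x₁ (∼-sym x x' x∼x') x∼x₁ , ∼-trans y' y y₁ (∼-sym y y' y∼y') y∼y₁ , d

  Dist2-resp : ∀ x x' y y' → x ∼ x' → y ∼ y' → Dist2 x y → Dist2 x' y'
  Dist2-resp x x' y y' x∼x' y∼y' (x≁y , not-adj , z , xz , zy) =
    ≁-resp x x' y y' x∼x' y∼y' x≁y ,
    (λ adj → not-adj (Adj-resp x' x y' y (∼-sym x x' x∼x') (∼-sym y y' y∼y') adj)) ,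
    z , Adj-resp x x' z z x∼x' (∼-refl z) xz , Adj-resp z z y y' (∼-refl z) y∼y' zy

  -- The halved graph as the image of one parity class.

  module Half (v₀ : Vtx n) where

    open Halved v₀

    -- An equation that replaces the existential `VΓ`; the next two lemmas show that they agree.
    InH : Vtx n → Set
    InH x = parity x ≡ parity v₀

    VΓ⇒InH : ∀ x → VΓ x → InH x
    VΓ⇒InH x (y , path , y∼x) = trans (sym (∼-parity y x y∼x)) (sym (along v₀ y path))
      where
      along : ∀ x y → Star Dist2 x y → parity x ≡ parity y
      along x .x ε                = refl
      along x y (_◅_ {j = z} d ds) = trans (Dist2-parity x z d) (along z y ds)

    InH⇒VΓ : ∀ x → InH x → VΓ x
    InH⇒VΓ x hx = x , coset-induction v₀ (Star Dist2 v₀) ε extend x hx , ∼-refl x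
      where
      extend : ∀ y u → InH y → weight u ≡ 2 → Star Dist2 v₀ y → Star Dist2 v₀ (y ⊕ u)
      extend y u _ wu path = path ◅◅ (near⇒Dist2 y (y ⊕ u) (trans (dist-shift y u) wu) ◅ ε)

    InH-⊕ : ∀ y u → InH y → weight u ≡ 2 → InH (y ⊕ u)
    InH-⊕ y u hy wu = trans (parity-⊕-weight-2 y u wu) hy

    -- One half of the normaliser condition makes the induced map well defined, the other makes it
    -- injective. `Dist2` goes both ways because it lifts to Hamming distance 2, which g preserves.
    normalizer⇒IsAutΓ : ∀ g → InNormalizer K g → IsAutΓ (act g)
    normalizer⇒IsAutΓ g (g-even , forth , back) = record
      { wellDef = λ { x _ _ (k , Kk , refl) → wellDefined x k Kk }
      ; maps    = λ x vx → InH⇒VΓ (act g x) (trans (parity-act-even g g-even x) (VΓ⇒InH x vx))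
      ; inj     = λ x y _ _ → injective x y
      ; surj    = λ y vy → act (g ⁻¹) y ,
                           InH⇒VΓ (act (g ⁻¹) y) (trans (parity-preimage g g-even y) (VΓ⇒InH y vy)) ,
                           subst (_∼ y) (sym (act-act-⁻¹ g y)) (∼-refl y)
      ; adj     = λ x y _ _ → mk⇔ (preserves x y) (reflects x y)
      }
      where
      wellDefined : ∀ x k → K k → act g x ∼ act g (act k x)
      wellDefined x k Kk with forth k Kk
      ... | k' , Kk' , eq = k' , Kk' , sym (eq x)
      injective : ∀ x y → act g x ∼ act g y → x ∼ y
      injective x y (k' , Kk' , eq') with back k' Kk'
      ... | k , Kk , eq = k , Kk , act-injective g (trans (eq x) eq')
      preserves : ∀ x y → Dist2 x y → Dist2 (act g x) (act g y)
      preserves x y d with Dist2-lift x y d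
      ... | _ , (k , Kk , refl) , d' = Dist2-resp (act g x) (act g x) (act g (act k y)) (act g y)
            (∼-refl (act g x)) (∼-sym (act g y) (act g (act k y)) (wellDefined y k Kk))
            (near⇒Dist2 (act g x) (act g (act k y)) (trans (dist-act g x (act k y)) d'))
      reflects : ∀ x y → Dist2 (act g x) (act g y) → Dist2 x y
      reflects x y d with Dist2-lift (act g x) (act g y) d
      ... | y' , gy∼y' , d' = Dist2-resp x x y'' y (∼-refl x) (∼-sym y y'' y∼y'')
            (near⇒Dist2 x y'' (trans (sym (dist-act g x y''))
              (trans (cong (dist (act g x)) (act-act-⁻¹ g y')) d')))
        where
        y'' = act (g ⁻¹) y'
        y∼y'' : y ∼ y''
        y∼y'' = injective y y'' (subst (act g y ∼_) (sym (act-act-⁻¹ g y')) gy∼y')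

    -- The element k ∈ K agreeing with h at v₀ agrees with h on the whole half: going from y to a
    -- vertex at distance 2, the images under h and k lie in one K-orbit at distance at most 4.
    fixes-orbits⇒K : 3 ≤ n → ∀ h → (∀ y → InH y → act h y ∼ y) → K h
    fixes-orbits⇒K 3≤n h fix with ∼-sym (act h v₀) v₀ (fix v₀ refl)
    ... | k , Kk , kv₀≡hv₀ = respects k h k≈h Kk
      where
      step : ∀ y u → InH y → weight u ≡ 2 → act k y ≡ act h y → act k (y ⊕ u) ≡ act h (y ⊕ u)
      step y u hy wu eq = sym (∼-rigid (act h y') (act k y')
          (∼-trans (act h y') y' (act k y') (fix y' (InH-⊕ y u hy wu)) (k , Kk , refl)) (begin
        dist (act h y') (act k y')  ≡⟨ cong₂ dist (act-⊕ h y u) (trans (act-⊕ k y u) (cong (_⊕ ku) eq)) ⟩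
        dist (act h y ⊕ hu) (act h y ⊕ ku) ≡⟨ dist-translate (act h y) hu ku ⟩
        dist hu ku ≤⟨ weight-2-dist-≤ hu ku (trans (weight-permute (proj₂ h) u) wu)
                                            (trans (weight-permute (proj₂ k) u) wu) ⟩
        4          ≤⟨ ℕ.m≤m+n 4 2 ⟩
        6          ∎))
        where
        open ℕ.≤-Reasoning
        y' = y ⊕ u
        hu = permute (proj₂ h) u
        ku = permute (proj₂ k) u
      on-half : ∀ y → InH y → act k y ≡ act h y
      on-half = coset-induction v₀ (λ y → act k y ≡ act h y) kv₀≡hv₀ step
      -- Agreement around v₀ forces equal permutations. This extends the equality of k and h to the
      -- other half, as membership in K is transferred only along equality on the whole cube.
      linear : ∀ z → permute (proj₂ k) z ≡ permute (proj₂ h) z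
      linear = permute-determined 3≤n (proj₂ k) (proj₂ h) λ u wu → ⊕-injective (act h v₀) (begin
        act h v₀ ⊕ permute (proj₂ k) u  ≡⟨ cong (_⊕ permute (proj₂ k) u) kv₀≡hv₀ ⟨
        act k v₀ ⊕ permute (proj₂ k) u  ≡⟨ act-⊕ k v₀ u ⟨
        act k (v₀ ⊕ u)                  ≡⟨ on-half (v₀ ⊕ u) (InH-⊕ v₀ u refl wu) ⟩
        act h (v₀ ⊕ u)                  ≡⟨ act-⊕ h v₀ u ⟩
        act h v₀ ⊕ permute (proj₂ h) u  ∎)
        where open ≡-Reasoning
      k≈h : k ≈ᴬ h
      k≈h x = begin
        act k x                                ≡⟨ cong (act k) (⊕-cancel v₀ x) ⟨
        act k (v₀ ⊕ (v₀ ⊕ x))                  ≡⟨ act-⊕ k v₀ (v₀ ⊕ x) ⟩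
        act k v₀ ⊕ permute (proj₂ k) (v₀ ⊕ x)  ≡⟨ cong₂ _⊕_ kv₀≡hv₀ (linear (v₀ ⊕ x)) ⟩
        act h v₀ ⊕ permute (proj₂ h) (v₀ ⊕ x)  ≡⟨ act-⊕ h v₀ (v₀ ⊕ x) ⟨
        act h (v₀ ⊕ (v₀ ⊕ x))                  ≡⟨ cong (act h) (⊕-cancel v₀ x) ⟩
        act h x                                ∎
        where open ≡-Reasoning

    -- Metric behaviour of an automorphism of the halved graph.

    module Lifting (5≤n : 5 ≤ n) (f : Vtx n → Vtx n) (f-aut : IsAutΓ f) where

      open IsAutΓ f-aut

      f-InH : ∀ x → InH x → InH (f x)
      f-InH x hx = VΓ⇒InH (f x) (maps x (InH⇒VΓ x hx))

      -- Only the orbit of `f x` is meaningful, so images are followed through arbitrary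
      -- representatives x̂.
      Lifts : Vtx n → Vtx n → Set
      Lifts x x̂ = InH x × f x ∼ x̂

      Lifts-InH : ∀ x x̂ → Lifts x x̂ → InH x̂
      Lifts-InH x x̂ (hx , fx) = trans (sym (∼-parity (f x) x̂ fx)) (f-InH x hx)

      Dist2-image : ∀ x y x̂ ŷ → Lifts x x̂ → Lifts y ŷ → Dist2 x y → Dist2 x̂ ŷ
      Dist2-image x y x̂ ŷ (hx , fx) (hy , fy) d = Dist2-resp (f x) x̂ (f y) ŷ fx fy
        (Equivalence.to (adj x y (InH⇒VΓ x hx) (InH⇒VΓ y hy)) d)

      Dist2-preimage : ∀ x y x̂ ŷ → Lifts x x̂ → Lifts y ŷ → Dist2 x̂ ŷ → Dist2 x y
      Dist2-preimage x y x̂ ŷ (hx , fx) (hy , fy) d =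
        Equivalence.from (adj x y (InH⇒VΓ x hx) (InH⇒VΓ y hy))
          (Dist2-resp x̂ (f x) ŷ (f y) (∼-sym (f x) x̂ fx) (∼-sym (f y) ŷ fy) d)

      -- The representative of y at distance 2 from x is within 4 + 2 = 6 of y, so it is y itself.
      -- The bound 4 is what two neighbours of a common vertex provide.
      Dist2-rigid : ∀ x y → Dist2 x y → dist x y ≤ 4 → dist x y ≡ 2
      Dist2-rigid x y d close with Dist2-lift x y d
      ... | y' , y∼y' , d' = trans (cong (dist x) (∼-rigid y y' y∼y' near)) d'
        where
        near : dist y y' ≤ 6
        near = ℕ.≤-trans (dist-triangle y x y')
          (ℕ.+-mono-≤ (subst (_≤ 4) (dist-sym x y) close) (ℕ.≤-reflexive d'))

      edge-image : ∀ x y x̂ ŷ → Lifts x x̂ → Lifts y ŷ → dist x̂ ŷ ≤ 4 → dist x y ≡ 2 → dist x̂ ŷ ≡ 2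
      edge-image x y x̂ ŷ lx ly close d =
        Dist2-rigid x̂ ŷ (Dist2-image x y x̂ ŷ lx ly (near⇒Dist2 x y d)) close

      -- At distance 0 injectivity of f puts x and y in one orbit, and rigidity makes them equal.
      -- Distance 1 contradicts parity, and distance 2 is pulled back as `Dist2`.
      edge-preimage : ∀ x y x̂ ŷ → Lifts x x̂ → Lifts y ŷ → dist x y ≤ 4 → dist x̂ ŷ ≤ 2 → dist x y ≤ 2
      edge-preimage x y x̂ ŷ lx@(hx , fx) ly@(hy , fy) close = by-distance (dist x̂ ŷ) refl
        where
        by-distance : ∀ m → dist x̂ ŷ ≡ m → m ≤ 2 → dist x y ≤ 2
        by-distance 0 d _ = subst (λ w → dist x w ≤ 2)
          (∼-rigid x y (inj x y (InH⇒VΓ x hx) (InH⇒VΓ y hy) fx∼fy) (ℕ.≤-trans close (ℕ.m≤m+n 4 2)))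
          (subst (_≤ 2) (sym (dist-self x)) z≤n)
          where
          open ∼-Reasoning
          fx∼fy : f x ∼ f y
          fx∼fy = begin
            f x  ≈⟨ fx ⟩
            x̂    ≡⟨ dist≡0⇒≡ x̂ ŷ d ⟩
            ŷ    ≈⟨ fy ⟨
            f y  ∎
        by-distance 1 d _ with () ← trans (cong odd (sym d)) (trans (sym (parity-dist x̂ ŷ))
          (trans (cong₂ _xor_ (Lifts-InH x x̂ lx) (Lifts-InH y ŷ ly)) (𝔹.xor-same (parity v₀))))
        by-distance 2 d _ =
          ℕ.≤-reflexive (Dist2-rigid x y (Dist2-preimage x y x̂ ŷ lx ly (near⇒Dist2 x̂ ŷ d)) close)
        by-distance (suc (suc (suc _))) _ (s≤s (s≤s ()))

      -- The permutation induced on the neighbours of a vertex.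

      choice : (P : Vtx n → Vtx n → Set) → (∀ z → weight z ≡ 2 → ∃[ w ] P z w) →
               ∃[ F ] (∀ z → weight z ≡ 2 → P z (F z))
      choice P pick = F , F-spec
        where
        F : Vtx n → Vtx n
        -- Deciding the weight makes `F` a function of z alone; vectors of other weights get the
        -- default 𝟘.
        F z with weight z ℕ.≟ 2
        ... | yes wz = proj₁ (pick z wz)
        ... | no  _  = 𝟘
        F-spec : ∀ z → weight z ≡ 2 → P z (F z)
        F-spec z wz with weight z ℕ.≟ 2
        ... | yes wz = proj₂ (pick z wz)
        ... | no  ¬wz = ⊥-elim (¬wz wz)

      lift-neighbour : ∀ y ŷ → Lifts y ŷ → ∀ z → weight z ≡ 2 →
                       ∃[ w ] (weight w ≡ 2 × f (y ⊕ z) ∼ (ŷ ⊕ w))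
      lift-neighbour y ŷ ly z wz = from-lift (Dist2-lift ŷ (f (y ⊕ z))
          (Dist2-image y (y ⊕ z) ŷ (f (y ⊕ z)) ly (InH-⊕ y z (proj₁ ly) wz , ∼-refl (f (y ⊕ z)))
            (near⇒Dist2 y (y ⊕ z) (trans (dist-shift y z) wz))))
        where
        from-lift : ∃[ y' ] (f (y ⊕ z) ∼ y' × dist ŷ y' ≡ 2) →
                    ∃[ w ] (weight w ≡ 2 × f (y ⊕ z) ∼ (ŷ ⊕ w))
        from-lift (y' , f∼y' , d) = ŷ ⊕ y' , d , subst (f (y ⊕ z) ∼_) (sym (⊕-cancel ŷ y')) f∼y'

      LocalPermutation : Vtx n → Vtx n → Permutation′ n → Set
      LocalPermutation y ŷ σ = ∀ z → weight z ≡ 2 → f (y ⊕ z) ∼ (ŷ ⊕ permute σ z)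

      module _ (y ŷ : Vtx n) (hy : InH y) (F : Vtx n → Vtx n)
        (F-spec : ∀ z → weight z ≡ 2 → weight (F z) ≡ 2 × f (y ⊕ z) ∼ (ŷ ⊕ F z)) where

        lifts-neighbour : ∀ z → weight z ≡ 2 → Lifts (y ⊕ z) (ŷ ⊕ F z)
        lifts-neighbour z wz = InH-⊕ y z hy wz , proj₂ (F-spec z wz)

        neighbours-adjacent : ∀ z z' → weight z ≡ 2 → weight z' ≡ 2 →
                              dist z z' ≡ 2 → dist (F z) (F z') ≡ 2
        neighbours-adjacent z z' wz wz' d = trans (sym (dist-translate ŷ (F z) (F z')))
          (edge-image (y ⊕ z) (y ⊕ z') (ŷ ⊕ F z) (ŷ ⊕ F z')
            (lifts-neighbour z wz) (lifts-neighbour z' wz')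
            (subst (_≤ 4) (sym (dist-translate ŷ (F z) (F z')))
              (weight-2-dist-≤ (F z) (F z') (proj₁ (F-spec z wz)) (proj₁ (F-spec z' wz'))))
            (trans (dist-translate y z z') d))

        neighbours-reflected : ∀ z z' → weight z ≡ 2 → weight z' ≡ 2 →
                               dist (F z) (F z') ≤ 2 → dist z z' ≤ 2
        neighbours-reflected z z' wz wz' d = subst (_≤ 2) (dist-translate y z z')
          (edge-preimage (y ⊕ z) (y ⊕ z') (ŷ ⊕ F z) (ŷ ⊕ F z')
            (lifts-neighbour z wz) (lifts-neighbour z' wz')
            (subst (_≤ 4) (sym (dist-translate y z z')) (weight-2-dist-≤ z z' wz wz'))
            (subst (_≤ 2) (sym (dist-translate ŷ (F z) (F z'))) d))

        permutes-neighbours : ∃[ σ ] LocalPermutation y ŷ σ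
        permutes-neighbours = from-permutation (Triangular.induced 5≤n F
            (λ z wz → proj₁ (F-spec z wz)) neighbours-adjacent neighbours-reflected)
          where
          from-permutation : ∃[ σ ] (∀ z → weight z ≡ 2 → F z ≡ permute σ z) →
                             ∃[ σ ] LocalPermutation y ŷ σ
          from-permutation (σ , F≡σ) = σ , λ z wz →
            subst (λ w → f (y ⊕ z) ∼ (ŷ ⊕ w)) (F≡σ z wz) (proj₂ (F-spec z wz))

      local-permutation : ∀ y ŷ → Lifts y ŷ → ∃[ σ ] LocalPermutation y ŷ σ
      local-permutation y ŷ ly = from-choice
          (choice (λ z w → weight w ≡ 2 × f (y ⊕ z) ∼ (ŷ ⊕ w)) (lift-neighbour y ŷ ly))
        where
        from-choice : ∃[ F ] (∀ z → weight z ≡ 2 → weight (F z) ≡ 2 × f (y ⊕ z) ∼ (ŷ ⊕ F z)) →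
                      ∃[ σ ] LocalPermutation y ŷ σ
        from-choice (F , F-spec) = permutes-neighbours y ŷ (proj₁ ly) F F-spec

      -- The neighbours are included to make the property pass to the next vertex: the permutation
      -- found there is compared with that of g on common neighbours.
      AgreesNear : AutQ n → Vtx n → Set
      AgreesNear g y = f y ∼ act g y × (∀ z → weight z ≡ 2 → f (y ⊕ z) ∼ act g (y ⊕ z))

      -- The permutations σ of g and τ found at y ⊕ u agree on the common neighbours of y and y ⊕ u.
      -- For u = e i ⊕ e j these include all e i ⊕ e c, which span the vectors of weight 2.
      module _ (g : AutQ n) (y : Vtx n) (at-y : f y ∼ act g y)
        (near-y : ∀ z → weight z ≡ 2 → f (y ⊕ z) ∼ act g (y ⊕ z)) (i j : Fin n) (i≢j : i ≢ j)
        where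

        private
          u = e i ⊕ e j
          wu = weight-e⊕e i j i≢j
          y' = y ⊕ u
          ŷ = act g y'
          σ = proj₂ g

        module _ (τ : Permutation′ n) (near-τ : LocalPermutation y' ŷ τ) where

          -- Both sides, added to ŷ, lie in the orbit of `f (y' ⊕ z)`. As vectors of weight 2 they
          -- are at distance at most 4, so rigidity identifies them.
          common : ∀ z → weight z ≡ 2 → f (y ⊕ (u ⊕ z)) ∼ act g (y ⊕ (u ⊕ z)) →
                   permute σ z ≡ permute τ z
          common z wz f∼g = ⊕-injective ŷ (∼-rigid (ŷ ⊕ permute σ z) (ŷ ⊕ permute τ z)
              (∼-trans (ŷ ⊕ permute σ z) (f (y' ⊕ z)) (ŷ ⊕ permute τ z)
                (∼-sym (f (y' ⊕ z)) (ŷ ⊕ permute σ z) f∼gσ) (near-τ z wz)) (begin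
            dist (ŷ ⊕ permute σ z) (ŷ ⊕ permute τ z)  ≡⟨ dist-translate ŷ (permute σ z) (permute τ z) ⟩
            dist (permute σ z) (permute τ z)          ≤⟨ weight-2-dist-≤ (permute σ z) (permute τ z)
              (trans (weight-permute σ z) wz) (trans (weight-permute τ z) wz) ⟩
            4                                         ≤⟨ ℕ.m≤m+n 4 2 ⟩
            6                                         ∎))
            where
            open ℕ.≤-Reasoning
            f∼gσ : f (y' ⊕ z) ∼ (ŷ ⊕ permute σ z)
            f∼gσ = subst (f (y' ⊕ z) ∼_) (act-⊕ g y' z)
              (subst (λ w → f w ∼ act g w) (sym (⊕-assoc y u z)) f∼g)

          agree-at : ∀ c → permute σ (e i ⊕ e c) ≡ permute τ (e i ⊕ e c)
          agree-at c with c F.≟ i | c F.≟ j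
          ... | yes refl | _ = trans (cong (permute σ) (⊕-self (e i)))
                (trans (permute-𝟘 σ) (sym (trans (cong (permute τ) (⊕-self (e i))) (permute-𝟘 τ))))
          -- For c = j the neighbour of `y'` in question is y itself. For the remaining c, the sum
          -- of u and e i ⊕ e c is e j ⊕ e c, again of weight 2.
          ... | no _ | yes refl = common u wu (subst (λ w → f w ∼ act g w)
                (sym (trans (cong (y ⊕_) (⊕-self u)) (⊕-identityʳ y))) at-y)
          ... | no c≢i | no c≢j = common (e i ⊕ e c) (weight-e⊕e i c (c≢i ∘ sym))
                (near-y (u ⊕ (e i ⊕ e c)) (dist-meeting-pairs i j c (c≢j ∘ sym)))

          same-permutation : ∀ z → weight z ≡ 2 → permute σ z ≡ permute τ z
          same-permutation z wz with weight≡2⇒pair z wz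
          ... | c , d , _ , refl = begin
            permute σ (e c ⊕ e d)                            ≡⟨ cong (permute σ) (⊕-cancel-common (e i) (e c) (e d)) ⟨
            permute σ ((e i ⊕ e c) ⊕ (e i ⊕ e d))            ≡⟨ permute-⊕ σ (e i ⊕ e c) (e i ⊕ e d) ⟩
            permute σ (e i ⊕ e c) ⊕ permute σ (e i ⊕ e d)    ≡⟨ cong₂ _⊕_ (agree-at c) (agree-at d) ⟩
            permute τ (e i ⊕ e c) ⊕ permute τ (e i ⊕ e d)    ≡⟨ permute-⊕ τ (e i ⊕ e c) (e i ⊕ e d) ⟨
            permute τ ((e i ⊕ e c) ⊕ (e i ⊕ e d))            ≡⟨ cong (permute τ) (⊕-cancel-common (e i) (e c) (e d)) ⟩
            permute τ (e c ⊕ e d)                            ∎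
            where open ≡-Reasoning

      propagate : ∀ g y u → InH y → weight u ≡ 2 → AgreesNear g y → AgreesNear g (y ⊕ u)
      propagate g y u hy wu (at-y , near-y) = go u wu (weight≡2⇒pair u wu)
        where
        go : ∀ u → weight u ≡ 2 → ∃[ i ] ∃[ j ] (i ≢ j × u ≡ e i ⊕ e j) → AgreesNear g (y ⊕ u)
        go _ wu (i , j , i≢j , refl) = near-y (e i ⊕ e j) wu ,
            from-local (local-permutation y' (act g y') (InH-⊕ y (e i ⊕ e j) hy wu , near-y (e i ⊕ e j) wu))
          where
          y' = y ⊕ (e i ⊕ e j)
          from-local : ∃[ τ ] LocalPermutation y' (act g y') τ →
                       ∀ z → weight z ≡ 2 → f (y' ⊕ z) ∼ act g (y' ⊕ z)
          from-local (τ , near-τ) z wz = subst (f (y' ⊕ z) ∼_)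
            (trans (cong (act g y' ⊕_) (sym (same-permutation g y at-y near-y i j i≢j τ near-τ z wz)))
              (sym (act-⊕ g y' z)))
            (near-τ z wz)

      -- `affine` combines the permutation found at v₀ with the value `f v₀`; agreement then spreads
      -- over the half in steps of weight 2.
      lift : ∃[ g ] (act g v₀ ≡ f v₀ × (∀ y → InH y → f y ∼ act g y))
      lift = from-local (local-permutation v₀ (f v₀) (refl , ∼-refl (f v₀)))
        where
        from-local : ∃[ σ ] LocalPermutation v₀ (f v₀) σ →
                     ∃[ g ] (act g v₀ ≡ f v₀ × (∀ y → InH y → f y ∼ act g y))
        from-local (σ , near-σ) with affine v₀ (f v₀) σ
        ... | g , refl , gv₀ = g , gv₀ ,
              λ y hy → proj₁ (coset-induction v₀ (AgreesNear g) base (propagate g) y hy)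
          where
          base : AgreesNear g v₀
          base = subst (f v₀ ∼_) (sym gv₀) (∼-refl (f v₀)) , λ z wz → subst (f (v₀ ⊕ z) ∼_)
            (trans (cong (_⊕ permute (proj₂ g) z) (sym gv₀)) (sym (act-⊕ g v₀ z))) (near-σ z wz)

      -- The lift is even and normalises K.

      module _ (g : AutQ n) (gv₀ : act g v₀ ≡ f v₀) (f∼g : ∀ y → InH y → f y ∼ act g y) where

        private
          3≤n : 3 ≤ n
          3≤n = ℕ.≤-trans (ℕ.m≤m+n 3 2) 5≤n

        -- Both v₀ and its image `f v₀` lie in the half, so the translation part of g is even.
        g-even : InES g
        g-even = parity⇒InE (proj₁ g) (cancel (parity v₀) _
          (trans (sym (parity-act g v₀)) (trans (cong parity gv₀) (f-InH v₀ refl))))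
          where
          cancel : ∀ a b → a xor b ≡ a → b ≡ false
          cancel false b     eq = eq
          cancel true  false eq = refl

        -- The conjugate preserves the orbits of the half because f is well defined: x and its image
        -- under k have equivalent images under f, hence under g.
        forth-conjugate : ∀ k → K k → ∃[ k' ] (K k' × (∀ x → act g (act k x) ≡ act k' (act g x)))
        forth-conjugate k Kk = k' , fixes-orbits⇒K 3≤n k' fix , λ x →
          sym (trans (act-k' (act g x)) (cong (act g ∘ act k) (act-⁻¹-act g x)))
          where
          k' = g ⁻¹ ∙ k ∙ g
          act-k' : ∀ x → act k' x ≡ act g (act k (act (g ⁻¹) x))
          act-k' x = trans (act-∙ (g ⁻¹ ∙ k) g x) (cong (act g) (act-∙ (g ⁻¹) k x))
          fix : ∀ y → InH y → act k' y ∼ y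
          fix y hy = begin
            act k' y        ≡⟨ act-k' y ⟩
            act g (act k x) ≈⟨ f∼g (act k x) (trans (parity-act-even k (K-even k Kk) x) hx) ⟨
            f (act k x)     ≈⟨ wellDef x (act k x) (InH⇒VΓ x hx) (k , Kk , refl) ⟨
            f x             ≈⟨ f∼g x hx ⟩
            act g x         ≡⟨ act-act-⁻¹ g y ⟩
            y               ∎
            where
            open ∼-Reasoning
            x = act (g ⁻¹) y
            hx : InH x
            hx = trans (parity-preimage g g-even y) hy

        -- Here injectivity of f is what pulls the equivalence of `act k' (act g y)` and `act g y`
        -- back to y.
        back-conjugate : ∀ k' → K k' → ∃[ k ] (K k × (∀ x → act g (act k x) ≡ act k' (act g x)))
        back-conjugate k' Kk' = k , fixes-orbits⇒K 3≤n k fix , intertwines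
          where
          k = g ∙ k' ∙ g ⁻¹
          act-k : ∀ x → act k x ≡ act (g ⁻¹) (act k' (act g x))
          act-k x = trans (act-∙ (g ∙ k') (g ⁻¹) x) (cong (act (g ⁻¹)) (act-∙ g k' x))
          intertwines : ∀ x → act g (act k x) ≡ act k' (act g x)
          intertwines x = trans (cong (act g) (act-k x)) (act-act-⁻¹ g (act k' (act g x)))
          fix : ∀ y → InH y → act k y ∼ y
          fix y hy = inj (act k y) y (InH⇒VΓ (act k y) hky) (InH⇒VΓ y hy) (begin
            f (act k y)       ≈⟨ f∼g (act k y) hky ⟩
            act g (act k y)   ≡⟨ intertwines y ⟩
            act k' (act g y)  ≈⟨ k' , Kk' , refl ⟨
            act g y           ≈⟨ f∼g y hy ⟨
            f y               ∎)
            where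
            open ∼-Reasoning
            hky : InH (act k y)
            hky = trans (cong parity (act-k y)) (trans (parity-preimage g g-even (act k' (act g y)))
              (trans (parity-act-even k' (K-even k' Kk') (act g y)) (trans (parity-act-even g g-even y) hy)))

      induced-by-normalizer : ∃[ g ] (InNormalizer K g × (∀ x → VΓ x → f x ∼ act g x))
      induced-by-normalizer = from-lift lift
        where
        from-lift : ∃[ g ] (act g v₀ ≡ f v₀ × (∀ y → InH y → f y ∼ act g y)) →
                    ∃[ g ] (InNormalizer K g × (∀ x → VΓ x → f x ∼ act g x))
        from-lift (g , gv₀ , f∼g) = g ,
          (g-even g gv₀ f∼g , forth-conjugate g gv₀ f∼g , back-conjugate g gv₀ f∼g) , λ x vx → f∼g x (VΓ⇒InH x vx)

-- The equality with N/K is rendered as three facts about the action of the normaliser: it is by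
-- automorphisms of Γ, its kernel is K, and it yields every automorphism.
theorem1p5 : (n : ℕ) → 5 ≤ n → (K : AutQ n → Set) → IsSubgroup K → IsEvenSub K → dK≥ 7 K →
    (v₀ : Vtx n) →
    let open Quotient K in
    let open Halved v₀ in
    (∀ g → InNormalizer K g → IsAutΓ (act g))
    × (∀ g → InNormalizer K g → ((∀ x → VΓ x → act g x ∼ x) ⇔ K g))
    × (∀ f → IsAutΓ f → ∃[ g ] (InNormalizer K g × (∀ x → VΓ x → f x ∼ act g x)))
theorem1p5 n 5≤n K K-subgroup K-even K-far v₀ =
  normalizer⇒IsAutΓ ,
  (λ g _ → mk⇔ (λ fix → fixes-orbits⇒K (ℕ.≤-trans (ℕ.m≤m+n 3 2) 5≤n) g (λ y hy → fix y (InH⇒VΓ y hy)))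
               (λ Kg x _ → ∼-sym x (act g x) (g , Kg , refl))) ,
  Lifting.induced-by-normalizer 5≤n
  where
  open Covering K K-subgroup K-even K-far
  open Half v₀
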